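{- For $n\in\mathbb{N}$, the number of equivalence classes of the nesting-similarity relation $\sim_{ne}$ on $\mathcal{M}(n)$ equals $2\cdot 4^{n-1}-\frac{3n-1}{2n+2}\binom{2n}{n}$.
   Context: A matching on $[2n]$ is a partition of $[2n]$ into $n$ two-element blocks (edges); $\mathcal{M}(n)$ is the set of such matchings. Edges $A,B$ are nested if $\min A<\min B<\max B<\max A$ or vice versa; $ne(M)$ is the number of nested pairs of edges. For $M\in\mathcal{M}(m)$, its children are the matchings obtained by choosing $x\in\{2,\dots,2m+2\}$, relabeling the vertices of $M$ order-preservingly by $\{2,\dots,2m+2\}\setminus\{x\}$ and adding the edge $\{1,x\}$. $\mathcal{T}(M,0)=\{M\}$ and $\mathcal{T}(M,l+1)$ is the set of children of members of $\mathcal{T}(M,l)$. $M\sim_{ne}N$ means that the multisets $ne(\mathcal{T}(M,l))=\{ne(P):P\in\mathcal{T}(M,l)\}$ and $ne(\mathcal{T}(N,l))$ are equal for every $l\ge 0$. -}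

module Defs where

open import Data.Nat using (ℕ; zero; suc; _+_; _*_; _^_; _<_; _<ᵇ_; _⊓_; _⊔_)
open import Data.Nat.Combinatorics using (_C_)
open import Data.Bool using (Bool; _∧_; _∨_; if_then_else_)
open import Data.List using (List; []; _∷_; map; concatMap; length; upTo; filterᵇ)
open import Data.List.Relation.Unary.All using (All)
open import Data.List.Relation.Binary.Permutation.Propositional using (_↭_)
open import Data.Product using (Σ; ∃; _×_; _,_; proj₁)
open import Data.Fin using (Fin)
open import Relation.Binary.PropositionalEquality using (_≡_)
open import Data.Integer using (ℤ; +_) renaming (_-_ to _-ℤ_)
open import Data.Rational using (ℚ; _/_) renaming (_-_ to _-ℚ_; _*_ to _*ℚ_)

-- Vertices are labelled 1,2,...; an edge is an unordered pair stored as (a , b).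
Edge : Set
Edge = ℕ × ℕ

endpoints : List Edge → List ℕ
endpoints = concatMap (λ { (a , b) → a ∷ b ∷ [] })

oneTo : ℕ → List ℕ
oneTo k = map suc (upTo k)

IsMatching : ℕ → List Edge → Set
IsMatching n E = All (λ { (a , b) → a < b }) E × (endpoints E ↭ oneTo (2 * n))

Matching : ℕ → Set
Matching n = Σ (List Edge) (IsMatching n)

nestedᵇ : Edge → Edge → Bool
nestedᵇ (a , b) (c , d) =
  (((a ⊓ b) <ᵇ (c ⊓ d)) ∧ ((c ⊓ d) <ᵇ (c ⊔ d)) ∧ ((c ⊔ d) <ᵇ (a ⊔ b)))
  ∨ (((c ⊓ d) <ᵇ (a ⊓ b)) ∧ ((a ⊓ b) <ᵇ (a ⊔ b)) ∧ ((a ⊔ b) <ᵇ (c ⊔ d)))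

ne : List Edge → ℕ
ne [] = 0
ne (e ∷ es) = length (filterᵇ (nestedᵇ e) es) + ne es

-- order-preserving relabelling of [2m] onto {2,...,2m+2} \ {x}
relabel : ℕ → ℕ → ℕ
relabel x v = if suc v <ᵇ x then suc v else suc (suc v)

relabelEdge : ℕ → Edge → Edge
relabelEdge x (a , b) = (relabel x a , relabel x b)

children : List Edge → List (List Edge)
children E =
  map (λ x → (1 , x) ∷ map (relabelEdge x) E)
      (map (λ i → 2 + i) (upTo (suc (2 * length E))))

𝓣 : List Edge → ℕ → List (List Edge)
𝓣 E zero = E ∷ []
𝓣 E (suc l) = concatMap children (𝓣 E l)

_∼ne_ : List Edge → List Edge → Set
M ∼ne N = ∀ l → map ne (𝓣 M l) ↭ map ne (𝓣 N l)

HasNumClasses : ℕ → ℕ → Set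
HasNumClasses n k =
  Σ (Fin k → Matching n) λ r →
    (∀ i j → proj₁ (r i) ∼ne proj₁ (r j) → i ≡ j)
    × (∀ (M : Matching n) → ∃ λ i → proj₁ M ∼ne proj₁ (r i))

-- 2·4^{n-1} − (3n−1)/(2n+2) · binom(2n,n), with 2·4^{n-1} written as 4^n / 2
formula : ℕ → ℚ
formula n =
  ((+ (4 ^ n)) / 2)
  -ℚ ((((+ (3 * n)) -ℤ (+ 1)) / (2 * suc n)) *ℚ ((+ ((2 * n) C n)) / 1))

{-# OPTIONS --safe #-}

-- A new first edge {1, x} nests exactly the edges that end before x, so the child of M at position i has
-- ne(M) + c(i) nestings, where c(i) counts the edges of M that end among the first i vertices.
-- The function c of the child depends only on c and i, hence ne(M) and c determine all the multisets
-- ne(𝓣(M, l)).  Conversely level 0 gives ne(M), and level 1 gives c because c is nondecreasing.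
-- Now c is the Dyck path of openers and closers of M.  A closer that ends a step from height h may close any of
-- the h open edges, producing between 0 and h − 1 nestings, so the number of nestings of a matching
-- with path π takes every value between 0 and the sum of these h − 1.  Summing over all Dyck paths with
-- a closed form for the paths starting at an arbitrary height gives the formula.
module Submission where

open import Defs
open import Data.Bool using (Bool; true; false; _∧_; _∨_; if_then_else_)
open import Data.Bool.Properties using (∨-comm; ∨-identityʳ; ∧-zeroʳ; ∧-identityʳ)
open import Data.Integer as ℤ using (+_)
import Data.Integer.Properties as ℤ
import Data.Integer.Tactic.RingSolver as ℤSolver
open import Data.List
  using (List; []; _∷_; _++_; map; concatMap; length; upTo; applyUpTo; filterᵇ; iterate; lookup)
open import Data.List.Membership.Propositional using (_∈_; find)
open import Data.List.Membership.Propositional.Properties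
  using (∈-map⁺; ∈-map⁻; ∈-++⁺ˡ; ∈-++⁺ʳ; ∈-++⁻; ∈-∃++; ∈-concatMap⁺; ∈-concatMap⁻; ∈-upTo⁺; ∈-upTo⁻; ∈-lookup)
open import Data.List.Properties
  using (length-map; length-++; length-++-sucʳ; length-upTo; map-cong; map-∘; map-++; map-upTo;
         ++-identityʳ; ∷-injectiveˡ; ∷-injectiveʳ)
open import Data.List.Relation.Binary.Permutation.Propositional
  using (_↭_; refl; prep; swap; trans; ↭-sym; ↭-trans; ↭-reflexive; ↭⇒↭ₛ)
open import Data.List.Relation.Binary.Permutation.Propositional.Properties
  using (↭-length; filter-↭; ↭-singleton-inv; All-resp-↭; ∈-resp-↭; shift; shifts; drop-∷; ++⁺ˡ; ++⁺ʳ)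
open import Data.List.Relation.Binary.Pointwise as Pointwise using (Pointwise; []; _∷_)
open import Data.List.Relation.Unary.All as All using (All; []; _∷_)
import Data.List.Relation.Unary.All.Properties as All
open import Data.List.Relation.Unary.AllPairs as AllPairs using (AllPairs; []; _∷_)
import Data.List.Relation.Unary.AllPairs.Properties as AllPairs
open import Data.List.Relation.Unary.Any as Any using (here; there)
open import Data.List.Relation.Unary.Any.Properties using (lookup-index)
open import Data.List.Relation.Unary.Sorted.TotalOrder using (Sorted)
import Data.List.Relation.Unary.Sorted.TotalOrder.Properties as Sorted
open import Data.List.Relation.Unary.Unique.Propositional using (Unique)
import Data.List.Relation.Unary.Unique.Propositional.Properties as Unique
open import Data.Fin using (zero; suc)
open import Data.Nat
  using (ℕ; zero; suc; _+_; _*_; _∸_; _^_; _<_; _≤_; _<ᵇ_; _⊓_; _⊔_; _≟_; z≤n; s≤s; s≤s⁻¹)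
open import Data.Nat.Combinatorics using (_C_; nCn≡1; nCk≡nC[n∸k]; nCk+nC[k+1]≡[n+1]C[k+1])
open import Data.Nat.ListAction using (sum)
open import Data.Nat.ListAction.Properties using (sum-++)
open import Data.Nat.Properties hiding (_≟_)
open import Data.Nat.Tactic.RingSolver using (solve-∀)
open import Data.Product using (Σ; ∃; _×_; _,_; proj₁; proj₂)
open import Data.Rational as ℚ using (_/_; toℚᵘ; fromℚᵘ)
import Data.Rational.Properties as ℚ
open import Data.Rational.Unnormalised as ℚᵘ using (ℚᵘ; mkℚᵘ; *≡*)
import Data.Rational.Unnormalised.Properties as ℚᵘ
open import Data.Sum using (inj₁; inj₂)
open import Function using (_∘_; id; case_of_)
open import Relation.Binary.PropositionalEquality
  using (_≡_; _≢_; refl; sym; cong; cong₂; subst; subst₂; module ≡-Reasoning)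
  renaming (trans to ≡-trans)
open import Relation.Nullary using (yes; no; T?; contradiction)

private variable
  A B : Set

-- Counting list entries by a Boolean predicate

bit : Bool → ℕ
bit b = if b then 1 else 0

count : (A → Bool) → List A → ℕ
count p xs = length (filterᵇ p xs)

count-∷ : ∀ (p : A → Bool) x xs → count p (x ∷ xs) ≡ bit (p x) + count p xs
count-∷ p x xs with p x
... | true  = refl
... | false = refl

count-cong : ∀ {p q : A → Bool} {xs} → All (λ x → p x ≡ q x) xs → count p xs ≡ count q xs
count-cong [] = refl
count-cong {p = p} {q} {x ∷ xs} (e ∷ es) rewrite count-∷ p x xs | count-∷ q x xs =
  cong₂ _+_ (cong bit e) (count-cong es)

count-map : ∀ (p : B → Bool) (f : A → B) xs → count p (map f xs) ≡ count (p ∘ f) xs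
count-map p f []       = refl
count-map p f (x ∷ xs) rewrite count-∷ p (f x) (map f xs) | count-∷ (p ∘ f) x xs =
  cong (λ m → bit (p (f x)) + m) (count-map p f xs)

count-↭ : ∀ (p : A → Bool) {xs ys} → xs ↭ ys → count p xs ≡ count p ys
count-↭ p e = ↭-length (filter-↭ (T? ∘ p) e)

count-mono : ∀ {p q : A → Bool} → (∀ x → bit (p x) ≤ bit (q x)) → ∀ xs → count p xs ≤ count q xs
count-mono h [] = z≤n
count-mono {p = p} {q} h (x ∷ xs) rewrite count-∷ p x xs | count-∷ q x xs =
  +-mono-≤ (h x) (count-mono h xs)

<ᵇ-true : ∀ {m n} → m < n → (m <ᵇ n) ≡ true
<ᵇ-true {zero}  {suc n} _       = refl
<ᵇ-true {suc m} {suc n} (s≤s h) = <ᵇ-true h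

<ᵇ-false : ∀ {m n} → n ≤ m → (m <ᵇ n) ≡ false
<ᵇ-false {m}     {zero}  _       = refl
<ᵇ-false {suc m} {suc n} (s≤s h) = <ᵇ-false h

-- Nested pairs of edges

Ordered : Edge → Set
Ordered (a , b) = 0 < a × a < b

nestedᵇ-ordered : ∀ {a b c d} → a < b → c < d →
  nestedᵇ (a , b) (c , d) ≡ ((a <ᵇ c) ∧ (d <ᵇ b)) ∨ ((c <ᵇ a) ∧ (b <ᵇ d))
nestedᵇ-ordered a<b c<d
  rewrite m≤n⇒m⊓n≡m (<⇒≤ a<b) | m≤n⇒m⊔n≡n (<⇒≤ a<b)
        | m≤n⇒m⊓n≡m (<⇒≤ c<d) | m≤n⇒m⊔n≡n (<⇒≤ c<d)
        | <ᵇ-true a<b | <ᵇ-true c<d = refl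

nestedᵇ-comm : ∀ e f → nestedᵇ e f ≡ nestedᵇ f e
nestedᵇ-comm (a , b) (c , d) =
  ∨-comm (((a ⊓ b) <ᵇ (c ⊓ d)) ∧ ((c ⊓ d) <ᵇ (c ⊔ d)) ∧ ((c ⊔ d) <ᵇ (a ⊔ b))) _

-- `ne` compares each edge only with the later ones, so exchanging two neighbours merely reverses
-- their mutual comparison, and `nestedᵇ` is symmetric.
ne-↭ : ∀ {E F} → E ↭ F → ne E ≡ ne F
ne-↭ refl = refl
ne-↭ (prep e p) = cong₂ _+_ (count-↭ (nestedᵇ e) p) (ne-↭ p)
ne-↭ {E = _ ∷ _ ∷ E} {F = _ ∷ _ ∷ F} (swap e f p)
  rewrite count-∷ (nestedᵇ e) f E | count-∷ (nestedᵇ f) e F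
        | nestedᵇ-comm e f | count-↭ (nestedᵇ e) p | count-↭ (nestedᵇ f) p | ne-↭ p =
  +-exchange (bit (nestedᵇ f e)) (count (nestedᵇ e) F) (count (nestedᵇ f) F) (ne F)
  where
  +-exchange : ∀ x a b c → x + a + (b + c) ≡ x + b + (a + c)
  +-exchange = solve-∀
ne-↭ (trans p q) = ≡-trans (ne-↭ p) (ne-↭ q)

-- Children of a matching

closed : ℕ → List Edge → ℕ
closed i = count (λ e → proj₂ e <ᵇ suc i)

-- The index i is the number of old vertices left of the new closer, so x = 2 + i, and i runs from 0
-- to 2 * `length E`.
child : List Edge → ℕ → List Edge
child E i = (1 , 2 + i) ∷ map (relabelEdge (2 + i)) E

module _ (i : ℕ) where

  private
    ρ : ℕ → ℕ
    ρ = relabel (2 + i)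

  relabel-≤ : ∀ {v} → v ≤ i → ρ v ≡ suc v
  relabel-≤ v≤i rewrite <ᵇ-true (s≤s v≤i) = refl

  relabel-> : ∀ {v} → i < v → ρ v ≡ 2 + v
  relabel-> i<v rewrite <ᵇ-false i<v = refl

  relabel-mono-< : ∀ {u v} → u < v → ρ u < ρ v
  relabel-mono-< {u} {v} u<v with ≤-<-connex u i | ≤-<-connex v i
  ... | inj₁ u≤i | inj₁ v≤i rewrite relabel-≤ u≤i | relabel-≤ v≤i = s≤s u<v
  ... | inj₁ u≤i | inj₂ i<v rewrite relabel-≤ u≤i | relabel-> i<v = m≤n⇒m≤1+n (s≤s u<v)
  ... | inj₂ i<u | inj₁ v≤i = contradiction (<-trans i<u u<v) (≤⇒≯ v≤i)
  ... | inj₂ i<u | inj₂ i<v rewrite relabel-> i<u | relabel-> i<v = s≤s (s≤s u<v)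

  relabel-mono-≤ : ∀ {u v} → u ≤ v → ρ u ≤ ρ v
  relabel-mono-≤ u≤v with m≤n⇒m<n∨m≡n u≤v
  ... | inj₁ u<v  = <⇒≤ (relabel-mono-< u<v)
  ... | inj₂ refl = ≤-refl

  relabel-<ᵇ : ∀ u v → (ρ u <ᵇ ρ v) ≡ (u <ᵇ v)
  relabel-<ᵇ u v with <-≤-connex u v
  ... | inj₁ u<v = ≡-trans (<ᵇ-true (relabel-mono-< u<v)) (sym (<ᵇ-true u<v))
  ... | inj₂ v≤u = ≡-trans (<ᵇ-false (relabel-mono-≤ v≤u)) (sym (<ᵇ-false v≤u))

  relabel-pos : ∀ v → 0 < ρ v
  relabel-pos v with ≤-<-connex v i
  ... | inj₁ v≤i rewrite relabel-≤ v≤i = s≤s z≤n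
  ... | inj₂ i<v rewrite relabel-> i<v = s≤s z≤n

  relabel-ordered : ∀ {E} → All Ordered E → All Ordered (map (relabelEdge (2 + i)) E)
  relabel-ordered = All.map⁺ ∘ All.map λ { {a , _} (_ , a<b) → relabel-pos a , relabel-mono-< a<b }

  child-ordered : ∀ {E} → All Ordered E → All Ordered (child E i)
  child-ordered E< = (s≤s z≤n , s≤s (s≤s z≤n)) ∷ relabel-ordered E<

  nestedᵇ-relabel : ∀ {e f} → Ordered e → Ordered f →
    nestedᵇ (relabelEdge (2 + i) e) (relabelEdge (2 + i) f) ≡ nestedᵇ e f
  nestedᵇ-relabel {a , b} {c , d} (_ , e<) (_ , f<)
    rewrite nestedᵇ-ordered (relabel-mono-< e<) (relabel-mono-< f<) | nestedᵇ-ordered e< f<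
          | relabel-<ᵇ a c | relabel-<ᵇ d b | relabel-<ᵇ c a | relabel-<ᵇ b d = refl

  ne-relabel : ∀ {E} → All Ordered E → ne (map (relabelEdge (2 + i)) E) ≡ ne E
  ne-relabel [] = refl
  ne-relabel {e ∷ E} (e< ∷ E<) = cong₂ _+_
    (≡-trans (count-map _ (relabelEdge (2 + i)) E) (count-cong (All.map (nestedᵇ-relabel e<) E<)))
    (ne-relabel E<)

  relabel-<-new : ∀ v → (ρ v <ᵇ 2 + i) ≡ (v <ᵇ suc i)
  relabel-<-new v with ≤-<-connex v i
  ... | inj₁ v≤i rewrite relabel-≤ v≤i = refl
  ... | inj₂ i<v rewrite relabel-> i<v | <ᵇ-false i<v = <ᵇ-false (m≤n⇒m≤1+n i<v)

  -- Vertex 1 precedes every relabelled vertex, so the new edge can only be the outer one, and the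
  -- comparison of the closers decides.
  nestedᵇ-new : ∀ {e} → Ordered e →
    nestedᵇ (1 , 2 + i) (relabelEdge (2 + i) e) ≡ (proj₂ e <ᵇ suc i)
  nestedᵇ-new {a , b} (0<a , a<b)
    rewrite nestedᵇ-ordered {1} {2 + i} (s≤s (s≤s z≤n)) (relabel-mono-< a<b)
          | relabel-<-new b
          | <ᵇ-true (subst (_< ρ a) (relabel-≤ z≤n) (relabel-mono-< 0<a))
          | <ᵇ-false (relabel-pos a) = ∨-identityʳ _

  ne-child : ∀ {E} → All Ordered E → ne (child E i) ≡ closed i E + ne E
  ne-child {E} E< = cong₂ _+_
    (≡-trans (count-map _ (relabelEdge (2 + i)) E) (count-cong (All.map nestedᵇ-new E<)))
    (ne-relabel E<)

  closed-relabel : ∀ j k → (∀ v → (ρ v <ᵇ suc j) ≡ (v <ᵇ suc k)) → ∀ E →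
    closed j (map (relabelEdge (2 + i)) E) ≡ closed k E
  closed-relabel j k h E = ≡-trans (count-map _ (relabelEdge (2 + i)) E)
    (count-cong (All.universal (h ∘ proj₂) E))

  closed-child-0 : ∀ E → closed 0 (child E i) ≡ 0
  closed-child-0 E = none E
    where
    none : ∀ E → closed 0 (map (relabelEdge (2 + i)) E) ≡ 0
    none [] = refl
    none ((_ , b) ∷ E) rewrite <ᵇ-false (relabel-pos b) = none E

  -- The first suc j vertices of the child are the new opener 1 and the first j old vertices; the
  -- new closer 2 + i still lies to their right.
  closed-child-≤ : ∀ {j} → j ≤ i → ∀ E → closed (suc j) (child E i) ≡ closed j E
  closed-child-≤ {j} j≤i E rewrite <ᵇ-false j≤i = closed-relabel (suc j) j before E
    where
    before : ∀ v → (ρ v <ᵇ 2 + j) ≡ (v <ᵇ suc j)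
    before v with ≤-<-connex v i
    ... | inj₁ v≤i rewrite relabel-≤ v≤i = refl
    ... | inj₂ i<v rewrite relabel-> i<v | <ᵇ-false (≤-<-trans j≤i i<v) =
      <ᵇ-false (m≤n⇒m≤1+n (≤-<-trans j≤i i<v))

  -- Both new vertices now lie among the first 2 + j, together with exactly j old ones; the new
  -- closer accounts for the `suc`.
  closed-child-> : ∀ {j} → i ≤ j → ∀ E → closed (2 + j) (child E i) ≡ suc (closed j E)
  closed-child-> {j} i≤j E rewrite <ᵇ-true (s≤s i≤j) = cong suc (closed-relabel (2 + j) j after E)
    where
    after : ∀ v → (ρ v <ᵇ 3 + j) ≡ (v <ᵇ suc j)
    after v with ≤-<-connex v i
    ... | inj₁ v≤i rewrite relabel-≤ v≤i | <ᵇ-true (s≤s (≤-trans v≤i i≤j)) =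
      <ᵇ-true (m≤n⇒m≤1+n (s≤s (≤-trans v≤i i≤j)))
    ... | inj₂ i<v rewrite relabel-> i<v = refl

-- Invariants that determine the whole tree

record _≈ᵐ_ (E F : List Edge) : Set where
  field
    orderedˡ : All Ordered E
    orderedʳ : All Ordered F
    ≡-length : length E ≡ length F
    ≡-ne     : ne E ≡ ne F
    ≡-closed : ∀ i → closed i E ≡ closed i F
open _≈ᵐ_

-- By `ne-child` and the three `closed-child` lemmas, the invariants of a child are functions of i
-- and of the invariants of its parent. Hence the two trees agree position by position on every
-- level, without any reordering.
child-≈ᵐ : ∀ {E F} → E ≈ᵐ F → ∀ i → child E i ≈ᵐ child F i
child-≈ᵐ {E} {F} r i .orderedˡ = child-ordered i (orderedˡ r)
child-≈ᵐ {E} {F} r i .orderedʳ = child-ordered i (orderedʳ r)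
child-≈ᵐ {E} {F} r i .≡-length
  rewrite length-map (relabelEdge (2 + i)) E | length-map (relabelEdge (2 + i)) F = cong suc (≡-length r)
child-≈ᵐ {E} {F} r i .≡-ne
  rewrite ne-child i (orderedˡ r) | ne-child i (orderedʳ r) = cong₂ _+_ (≡-closed r i) (≡-ne r)
child-≈ᵐ {E} {F} r i .≡-closed zero = ≡-trans (closed-child-0 i E) (sym (closed-child-0 i F))
child-≈ᵐ {E} {F} r i .≡-closed (suc j) with ≤-<-connex j i
... | inj₁ j≤i = begin
  closed (suc j) (child E i)  ≡⟨ closed-child-≤ i j≤i E ⟩
  closed j E                  ≡⟨ ≡-closed r j ⟩
  closed j F                  ≡⟨ closed-child-≤ i j≤i F ⟨
  closed (suc j) (child F i)  ∎
  where open ≡-Reasoning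
child-≈ᵐ {E} {F} r i .≡-closed (suc (suc j)) | inj₂ (s≤s i≤j) = begin
  closed (2 + j) (child E i)  ≡⟨ closed-child-> i i≤j E ⟩
  suc (closed j E)            ≡⟨ cong suc (≡-closed r j) ⟩
  suc (closed j F)            ≡⟨ closed-child-> i i≤j F ⟨
  closed (2 + j) (child F i)  ∎
  where open ≡-Reasoning

children-child : ∀ E → children E ≡ map (child E) (upTo (suc (2 * length E)))
children-child E = sym (map-∘ (upTo (suc (2 * length E))))

children-≈ᵐ : ∀ {E F} → E ≈ᵐ F → Pointwise _≈ᵐ_ (children E) (children F)
children-≈ᵐ {E} {F} r rewrite children-child E | children-child F | ≡-length r =
  go (upTo (suc (2 * length F)))
  where
  go : ∀ is → Pointwise _≈ᵐ_ (map (child E) is) (map (child F) is)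
  go []       = []
  go (i ∷ is) = child-≈ᵐ r i ∷ go is

𝓣-≈ᵐ : ∀ {E F} → E ≈ᵐ F → ∀ l → Pointwise _≈ᵐ_ (𝓣 E l) (𝓣 F l)
𝓣-≈ᵐ r zero    = r ∷ []
𝓣-≈ᵐ r (suc l) = go (𝓣-≈ᵐ r l)
  where
  go : ∀ {Es Fs} → Pointwise _≈ᵐ_ Es Fs → Pointwise _≈ᵐ_ (concatMap children Es) (concatMap children Fs)
  go []       = []
  go (r ∷ rs) = Pointwise.++⁺ (children-≈ᵐ r) (go rs)

≈ᵐ⇒∼ne : ∀ {E F} → E ≈ᵐ F → E ∼ne F
≈ᵐ⇒∼ne r l = ↭-reflexive (go (𝓣-≈ᵐ r l))
  where
  go : ∀ {Es Fs} → Pointwise _≈ᵐ_ Es Fs → map ne Es ≡ map ne Fs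
  go []       = refl
  go (r ∷ rs) = cong₂ _∷_ (≡-ne r) (go rs)

-- Recovery of the invariants from similarity

closed-step : ∀ i E → closed i E ≤ closed (suc i) E
closed-step i = count-mono step
  where
  step : ∀ (e : Edge) → bit (proj₂ e <ᵇ suc i) ≤ bit (proj₂ e <ᵇ 2 + i)
  step (_ , b) with ≤-<-connex b i
  ... | inj₁ b≤i rewrite <ᵇ-true (m≤n⇒m≤1+n (s≤s b≤i)) | <ᵇ-true (s≤s b≤i) = ≤-refl
  ... | inj₂ i<b rewrite <ᵇ-false i<b = z≤n

∼ne⇒≡-ne : ∀ {E F} → E ∼ne F → ne E ≡ ne F
∼ne⇒≡-ne E∼F = ∷-injectiveˡ (↭-singleton-inv (E∼F 0))

profile : List Edge → List ℕ
profile E = applyUpTo (λ i → closed i E + ne E) (suc (2 * length E))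

ne-children : ∀ {E} → All Ordered E → map ne (𝓣 E 1) ≡ profile E
ne-children {E} E< = begin
  map ne (children E ++ [])                             ≡⟨ cong (map ne) (++-identityʳ (children E)) ⟩
  map ne (children E)                                   ≡⟨ cong (map ne) (children-child E) ⟩
  map ne (map (child E) (upTo (suc (2 * length E))))    ≡⟨ map-∘ (upTo (suc (2 * length E))) ⟨
  map (ne ∘ child E) (upTo (suc (2 * length E)))
    ≡⟨ map-cong (λ i → ne-child i E<) (upTo (suc (2 * length E))) ⟩
  map (λ i → closed i E + ne E) (upTo (suc (2 * length E)))
    ≡⟨ map-upTo (λ i → closed i E + ne E) (suc (2 * length E)) ⟩
  profile E                                             ∎
  where open ≡-Reasoning

-- The numbers closed i E + ne E increase with i, so the multiset on level 1 determines each of them.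
∼ne⇒≡-profile : ∀ {E F} → All Ordered E → All Ordered F → E ∼ne F → profile E ≡ profile F
∼ne⇒≡-profile {E} {F} E< F< E∼F = Pointwise.Pointwise-≡⇒≡
  (Sorted.↗↭↗⇒≋ ≤-totalOrder (sorted E) (sorted F)
    (↭⇒↭ₛ (subst₂ _↭_ (ne-children E<) (ne-children F<) (E∼F 1))))
  where
  sorted : ∀ E → Sorted ≤-totalOrder (profile E)
  sorted E = Sorted.applyUpTo⁺₂ ≤-totalOrder _ _ λ i → +-monoˡ-≤ (ne E) (closed-step i E)

applyUpTo-injective : ∀ (f g : ℕ → A) k → applyUpTo f k ≡ applyUpTo g k → ∀ {i} → i < k → f i ≡ g i
applyUpTo-injective f g (suc k) eq {zero}  _   = ∷-injectiveˡ eq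
applyUpTo-injective f g (suc k) eq {suc i} i<k =
  applyUpTo-injective (f ∘ suc) (g ∘ suc) k (∷-injectiveʳ eq) (s≤s⁻¹ i<k)

-- Level 0 equates `ne E` and `ne F`, which can then be cancelled from the two profiles. The bound
-- on i is the range of positions of the children.
∼ne⇒≡-closed : ∀ {E F} → All Ordered E → All Ordered F → length E ≡ length F → E ∼ne F →
  ∀ {i} → i ≤ 2 * length E → closed i E ≡ closed i F
∼ne⇒≡-closed {E} {F} E< F< len E∼F {i} i≤ = +-cancelʳ-≡ (ne E) _ _
  (subst (λ m → closed i E + ne E ≡ closed i F + m) (sym (∼ne⇒≡-ne E∼F))
    (applyUpTo-injective (λ i → closed i E + ne E) (λ i → closed i F + ne F) (suc (2 * length E))
      profiles (s≤s i≤)))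
  where
  profiles : profile E ≡ applyUpTo (λ i → closed i F + ne F) (suc (2 * length E))
  profiles = subst (λ m → profile E ≡ applyUpTo (λ i → closed i F + ne F) (suc (2 * m))) (sym len)
    (∼ne⇒≡-profile E< F< E∼F)

-- Lattice paths and their matchings

-- h is the starting height and u the number of up-steps; the path ends at height 0.
data Path : ℕ → ℕ → Set where
  stop : Path 0 0
  up   : ∀ {h u} → Path (suc h) u → Path h (suc u)
  down : ∀ {h u} → Path h u → Path (suc h) u

private variable
  h u q : ℕ
  os : List ℕ
  E : List Edge

weight : Path h u → ℕ
weight stop             = 0
weight (up π)           = weight π
weight (down {h = h} π) = h + weight π

-- After the end of the path the count stays constant, as `closed` does after the last vertex; thus
-- `scan-closed` can hold at every index.
downs : Path h u → ℕ → ℕ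
downs stop     _       = 0
downs π        zero    = 0
downs (up π)   (suc i) = downs π i
downs (down π) (suc i) = suc (downs π i)

downs-0 : (π : Path h u) → downs π 0 ≡ 0
downs-0 stop     = refl
downs-0 (up _)   = refl
downs-0 (down _) = refl

length-up : ∀ h u → suc (suc h + 2 * u) ≡ h + 2 * suc u
length-up h u rewrite +-suc u (u + 0) | +-suc h (suc (u + (u + 0))) | +-suc h (u + (u + 0)) = refl

-- The value at 1 is 0 for a first up-step and 1 for a first down-step; removing that step shifts
-- the index by one.
downs-injective : ∀ (π ρ : Path h u) → (∀ {i} → i ≤ h + 2 * u → downs π i ≡ downs ρ i) → π ≡ ρ
downs-injective stop stop eq = refl
downs-injective (up {h} {u} π) (up ρ) eq =
  cong up (downs-injective π ρ λ i≤ → eq (≤-trans (s≤s i≤) (≤-reflexive (length-up _ _))))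
downs-injective (down π) (down ρ) eq =
  cong down (downs-injective π ρ (suc-injective ∘ eq ∘ s≤s))
downs-injective (up π) (down ρ) eq =
  contradiction (≡-trans (sym (downs-0 π)) (eq {1} (s≤s z≤n))) 0≢1+n
downs-injective (down π) (up ρ) eq =
  contradiction (≡-trans (sym (downs-0 ρ)) (sym (eq {1} (s≤s z≤n)))) 0≢1+n

-- Scan q os π E: reading the vertices q+1, q+2, … from left to right, with the vertices in os opened but
-- not yet closed, gives the path π and closes the edges E in this order.
data Scan : ∀ {h u} → ℕ → List ℕ → Path h u → List Edge → Set where
  stop   : Scan q [] stop []
  opens  : ∀ {π : Path (suc h) u} → Scan (suc q) (suc q ∷ os) π E → Scan q os (up π) E
  closes : ∀ {π : Path h u} xs {o ys} → Scan (suc q) (xs ++ ys) π E →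
           Scan q (xs ++ o ∷ ys) (down π) ((o , suc q) ∷ E)

-- The newest open vertex stands first, so `ys` holds the openers to the left of o. Their edges
-- close later and therefore enclose the edge being closed.
nestings : ∀ {π : Path h u} → Scan q os π E → ℕ
nestings stop                   = 0
nestings (opens s)              = nestings s
nestings (closes _ {ys = ys} s) = length ys + nestings s

length-scan-open : {π : Path h u} → Scan q os π E → length os ≡ h
length-scan-open stop      = refl
length-scan-open (opens s) = suc-injective (length-scan-open s)
length-scan-open (closes xs {o} {ys} s) = ≡-trans (length-++-sucʳ xs o ys) (cong suc (length-scan-open s))

length-scan : {π : Path h u} → Scan q os π E → length E ≡ h + u
length-scan stop = refl
length-scan {h} (opens {u = u} s) = ≡-trans (length-scan s) (sym (+-suc h u))
length-scan (closes _ s) = cong suc (length-scan s)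

nestings≤weight : {π : Path h u} (s : Scan q os π E) → nestings s ≤ weight π
nestings≤weight stop      = z≤n
nestings≤weight (opens s) = nestings≤weight s
nestings≤weight (closes xs {ys = ys} s) = +-mono-≤
  (≤-trans (≤-trans (m≤n+m (length ys) (length xs)) (≤-reflexive (sym (length-++ xs))))
           (≤-reflexive (length-scan-open s)))
  (nestings≤weight s)

++-delete : ∀ {A : Set} {P : A → Set} xs {o ys} → All P (xs ++ o ∷ ys) → P o × All P (xs ++ ys)
++-delete []       (p ∷ ps) = p , ps
++-delete (_ ∷ xs) (p ∷ ps) with q , qs ← ++-delete xs ps = q , p ∷ qs

Opened : ℕ → ℕ → Set
Opened q o = 0 < o × o ≤ q

open-next : All (Opened q) os → All (Opened (suc q)) (suc q ∷ os)
open-next os≤ = (s≤s z≤n , ≤-refl) ∷ All.map (λ (0<o , o≤q) → 0<o , m≤n⇒m≤1+n o≤q) os≤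

scan-edges : {π : Path h u} → Scan q os π E → All (Opened q) os →
  All (λ e → Ordered e × q < proj₂ e) E
scan-edges stop      _   = []
scan-edges (opens s) os≤ =
  All.map (λ (e< , q<) → e< , <⇒≤ q<) (scan-edges s (open-next os≤))
scan-edges (closes xs s) os≤ with (0<o , o≤q) , os≤ ← ++-delete xs os≤ =
  ((0<o , s≤s o≤q) , ≤-refl) ∷
  -- `open-next` raises the bound on the open vertices to suc q; `All.tail` discards the new opener
  -- that it also adds.
  All.map (λ (e< , q<) → e< , <⇒≤ q<) (scan-edges s (All.tail (open-next os≤)))

scan-endpoints : {π : Path h u} → Scan q os π E → endpoints E ↭ os ++ iterate suc (suc q) (h + 2 * u)
scan-endpoints stop = refl
scan-endpoints {h} {suc u} {q} {os} (opens s) = ↭-trans (scan-endpoints s)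
  (↭-trans (↭-sym (shift (suc q) os _)) (++⁺ˡ os (↭-reflexive (cong (iterate suc (suc q)) (length-up _ _)))))
scan-endpoints {suc h} {u} {q} (closes {E = E} xs {o} {ys} s) =
  -- suc q moves to the head of the unread vertices, and o back between `xs` and `ys`.
  ↭-trans (prep o (↭-trans (prep (suc q) (scan-endpoints s)) (↭-sym (shift (suc q) (xs ++ ys) rest))))
    (↭-trans (↭-sym (shift o [] _)) (++⁺ʳ (suc q ∷ rest) (↭-sym (shift o xs ys))))
  where rest = iterate suc (2 + q) (h + 2 * u)

count-none : ∀ {A : Set} {p : A → Bool} {xs} → All (λ x → p x ≡ false) xs → count p xs ≡ 0
count-none [] = refl
count-none {p = p} {x ∷ xs} (e ∷ es) rewrite count-∷ p x xs | e = count-none es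

-- Each down-step closes one edge at the vertex just read, whichever opener it takes. So the closing
-- counts depend on the path alone.
scan-closed : {π : Path h u} → Scan q os π E → All (Opened q) os → ∀ i → closed (q + i) E ≡ downs π i
scan-closed {q = q} {π = π} s os≤ zero = ≡-trans (count-none (All.map none (scan-edges s os≤))) (sym (downs-0 π))
  where
  none : ∀ {e : Edge} → Ordered e × q < proj₂ e → (proj₂ e <ᵇ suc (q + 0)) ≡ false
  none (_ , q<) = <ᵇ-false (≤-trans (s≤s (≤-reflexive (+-identityʳ q))) q<)
scan-closed stop _ (suc i) = refl
scan-closed {q = q} {E = E} (opens s) os≤ (suc i) rewrite +-suc q i =
  scan-closed s (open-next os≤) i
scan-closed {q = q} (closes {E = E} xs {o} s) os≤ (suc i) with _ , os≤ ← ++-delete xs os≤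
  rewrite +-suc q i | <ᵇ-true (s≤s (m≤m+n (suc q) i)) =
  cong suc (scan-closed s (All.tail (open-next os≤)) i)

count-++ : ∀ {A : Set} (p : A → Bool) xs ys → count p (xs ++ ys) ≡ count p xs + count p ys
count-++ p []       ys = refl
count-++ p (x ∷ xs) ys
  rewrite count-∷ p x (xs ++ ys) | count-∷ p x xs | count-++ p xs ys = sym (+-assoc (bit (p x)) _ _)

count-all : ∀ {A : Set} {p : A → Bool} {xs} → All (λ x → p x ≡ true) xs → count p xs ≡ length xs
count-all [] = refl
count-all {p = p} {x ∷ xs} (e ∷ es) rewrite count-∷ p x xs | e = cong suc (count-all es)

-- Vertices opened later are at least suc q, hence not below t. The openers below t are therefore
-- already open, and each of them gets exactly one edge.
scan-openers : {π : Path h u} → Scan q os π E → ∀ {t} → t ≤ suc q →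
  count (λ e → proj₁ e <ᵇ t) E ≡ count (_<ᵇ t) os
scan-openers stop _ = refl
scan-openers {q = q} (opens {os = os} s) {t} t≤ =
  ≡-trans (scan-openers s (m≤n⇒m≤1+n t≤)) (≡-trans (count-∷ (_<ᵇ t) (suc q) os)
    (cong (λ b → bit b + count (_<ᵇ t) os) (<ᵇ-false t≤)))
scan-openers {q = q} (closes {E = E} xs {o} {ys} s) {t} t≤ = begin
  count (λ e → proj₁ e <ᵇ t) ((o , suc q) ∷ E)        ≡⟨ count-∷ (λ e → proj₁ e <ᵇ t) (o , suc q) E ⟩
  bit (o <ᵇ t) + count (λ e → proj₁ e <ᵇ t) E
    ≡⟨ cong (λ m → bit (o <ᵇ t) + m) (scan-openers s (m≤n⇒m≤1+n t≤)) ⟩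
  bit (o <ᵇ t) + count (_<ᵇ t) (xs ++ ys)             ≡⟨ count-∷ (_<ᵇ t) o (xs ++ ys) ⟨
  count (_<ᵇ t) (o ∷ xs ++ ys)                        ≡⟨ count-↭ (_<ᵇ t) (shift o xs ys) ⟨
  count (_<ᵇ t) (xs ++ o ∷ ys)                        ∎
  where open ≡-Reasoning

Descending : List ℕ → Set
Descending = AllPairs (λ x y → y < x)

descending-delete : ∀ xs {o ys} → Descending (xs ++ o ∷ ys) →
  All (o <_) xs × All (_< o) ys × Descending (xs ++ ys)
descending-delete []       (ys<o ∷ ds) = [] , ys<o , ds
descending-delete (x ∷ xs) (<x ∷ ds) with o<xs , ys<o , ds ← descending-delete xs ds | o<x , <x ← ++-delete xs <x =
  o<x ∷ o<xs , ys<o , <x ∷ ds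

-- The edges listed after (o, suc q) close later, so they nest with it exactly when their opener is
-- below o. By the descending order, the open vertices below o are those in `ys`.
scan-ne : {π : Path h u} (s : Scan q os π E) → All (Opened q) os → Descending os → ne E ≡ nestings s
scan-ne stop      _   _  = refl
scan-ne (opens s) os≤ ds = scan-ne s (open-next os≤) (All.map (s≤s ∘ proj₂) os≤ ∷ ds)
scan-ne {q = q} (closes {E = E} xs {o} {ys} s) os≤ ds
  with o<xs , ys<o , ds ← descending-delete xs ds | (0<o , o≤q) , os≤ ← ++-delete xs os≤ =
  cong₂ _+_ nested (scan-ne s (All.tail (open-next os≤)) ds)
  where
  open ≡-Reasoning
  nested-closing : ∀ {e} → Ordered e × suc q < proj₂ e → nestedᵇ (o , suc q) e ≡ (proj₁ e <ᵇ o)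
  nested-closing {a , b} ((_ , a<b) , q<b)
    rewrite nestedᵇ-ordered (s≤s o≤q) a<b | <ᵇ-true q<b | <ᵇ-false (<⇒≤ q<b)
          | ∧-zeroʳ (o <ᵇ a) = ∧-identityʳ _
  nested : count (nestedᵇ (o , suc q)) E ≡ length ys
  nested = begin
    count (nestedᵇ (o , suc q)) E
      ≡⟨ count-cong (All.map nested-closing (scan-edges s (All.tail (open-next os≤)))) ⟩
    count (λ e → proj₁ e <ᵇ o) E             ≡⟨ scan-openers s (m≤n⇒m≤1+n (m≤n⇒m≤1+n o≤q)) ⟩
    count (_<ᵇ o) (xs ++ ys)                 ≡⟨ count-++ (_<ᵇ o) xs ys ⟩
    count (_<ᵇ o) xs + count (_<ᵇ o) ys
      ≡⟨ cong₂ _+_ (count-none (All.map (<ᵇ-false ∘ <⇒≤) o<xs)) (count-all (All.map <ᵇ-true ys<o)) ⟩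
    length ys                                ∎

-- Matchings with a prescribed path and number of nestings

split-suffix : ∀ {A : Set} (xs : List A) {r} → r < length xs →
  ∃ λ ys → ∃ λ x → ∃ λ zs → xs ≡ ys ++ x ∷ zs × length zs ≡ r
split-suffix (x ∷ xs) {r} (s≤s r≤) with m≤n⇒m<n∨m≡n r≤
... | inj₂ r≡ = [] , x , xs , refl , sym r≡
... | inj₁ r< with ys , y , zs , refl , len ← split-suffix xs r< = x ∷ ys , y , zs , refl , len

split-sum : ∀ a b {v} → v ≤ a + b → ∃ λ r → ∃ λ s → r ≤ a × s ≤ b × r + s ≡ v
split-sum a b {v} v≤ with ≤-total v a
... | inj₁ v≤a = v , 0 , v≤a , z≤n , +-identityʳ v
... | inj₂ a≤v = a , v ∸ a , ≤-refl , m≤n+o⇒m∸n≤o v a v≤ , m+[n∸m]≡n a≤v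

-- A down-step to height h can create any number r ≤ h of nestings: close the open vertex that has r
-- older ones behind it. What the rest of the path can achieve depends only on how many vertices are
-- open, so the choices are independent.
scan-exists : ∀ q os (π : Path h u) → length os ≡ h → ∀ {v} → v ≤ weight π →
  ∃ λ E → Σ (Scan q os π E) λ s → nestings s ≡ v
scan-exists q [] stop refl z≤n = [] , stop , refl
scan-exists q os (up π) len v≤ with E , s , eq ← scan-exists (suc q) (suc q ∷ os) π (cong suc len) v≤ =
  E , opens s , eq
scan-exists q os (down {h = h} π) len v≤
  with r , t , r≤ , t≤ , refl ← split-sum h (weight π) v≤
  with xs , o , ys , refl , refl ← split-suffix os (subst (r <_) (sym len) (s≤s r≤))
  with E , s , refl ← scan-exists (suc q) (xs ++ ys) π
         (suc-injective (≡-trans (sym (length-++-sucʳ xs o ys)) len)) t≤ =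
  (o , suc q) ∷ E , closes xs s , refl

-- Every matching arises from a scan

iterate-> : ∀ q m → All (q <_) (iterate suc (suc q) m)
iterate-> q zero    = []
iterate-> q (suc m) = ≤-refl ∷ All.map <⇒≤ (iterate-> (suc q) m)

endpoints-↭ : ∀ {E F} → E ↭ F → endpoints E ↭ endpoints F
endpoints-↭ refl = refl
endpoints-↭ (prep (a , b) p) = prep a (prep b (endpoints-↭ p))
endpoints-↭ {E = e ∷ f ∷ E} {F} (swap (a , b) (c , d) p) =
  ↭-trans (shifts (a ∷ b ∷ []) (c ∷ d ∷ [])) (prep c (prep d (prep a (prep b (endpoints-↭ p)))))
endpoints-↭ (trans p q) = trans (endpoints-↭ p) (endpoints-↭ q)

endpoints-∈ : ∀ {E} {e : Edge} → e ∈ E → proj₂ e ∈ endpoints E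
endpoints-∈ (here refl) = there (here refl)
endpoints-∈ (there e∈)  = there (there (endpoints-∈ e∈))

-- With suc q used up as a closer, the remaining endpoints are at most q or at least 2 + q. This
-- yields the strict bound on closers with which the scan continues.
closer-≢ : ∀ m {q os E} → All (Opened q) os → endpoints E ↭ os ++ iterate suc (2 + q) m →
  ∀ {e : Edge} → e ∈ E → suc q ≢ proj₂ e
closer-≢ m {q} {os} os≤ p e∈ refl with ∈-++⁻ os (∈-resp-↭ p (endpoints-∈ e∈))
... | inj₁ q∈ = n≮n q (proj₂ (All.lookup os≤ q∈))
... | inj₂ q∈ = n≮n (suc q) (All.lookup (iterate-> (suc q) m) q∈)

-- Induction on the number m of unread vertices: suc q is a closer if it is the larger end of some
-- remaining edge, and an opener otherwise. A scan lists edges by closer, so E is recovered only up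
-- to a permutation.
scan-covers : ∀ m q os E → length os ≡ h → All (Opened q) os →
  All (λ e → Ordered e × q < proj₂ e) E → endpoints E ↭ os ++ iterate suc (suc q) m →
  ∃ λ u → h + 2 * u ≡ m × Σ (Path h u) λ π → ∃ λ F → E ↭ F × Scan q os π F
scan-covers zero q [] [] refl _ _ p = 0 , refl , stop , [] , refl , stop
scan-covers zero q (_ ∷ _) [] _ _ _ p with () ← ↭-length p
-- With no unread vertex, the closer of a remaining edge would be an open vertex, hence at most q.
scan-covers zero q os ((a , b) ∷ E) _ os≤ ((_ , q<b) ∷ _) p
  with b∈ ← ∈-resp-↭ p (there (here refl)) rewrite ++-identityʳ os =
  contradiction q<b (≤⇒≯ (proj₂ (All.lookup os≤ b∈)))
scan-covers {h} (suc m) q os E len os≤ E< p with Any.any? (λ e → proj₂ e ≟ suc q) E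
-- Nothing closes at suc q, which sharpens q < b to suc q < b for every remaining edge.
... | no q∉
  with u , eq , π , F , E↭F , s ← scan-covers {suc h} m (suc q) (suc q ∷ os) E (cong suc len) (open-next os≤)
         (All.zipWith (λ { ((e< , q<) , q≢) → e< , ≤∧≢⇒< q< (q≢ ∘ sym) }) (E< , All.¬Any⇒All¬ E q∉))
         (↭-trans p (shift (suc q) os _)) =
  suc u , ≡-trans (sym (length-up h u)) (cong suc eq) , up π , F , E↭F , opens s
... | yes q∈
  with (o , _) , e∈ , refl ← find q∈
  with E₁ , E₂ , refl ← ∈-∃++ e∈
  with E↭ ← shift (o , suc q) E₁ E₂
  with ((0<o , o<q) , _) ∷ E′< ← All-resp-↭ E↭ E<
  with p′ ← ↭-trans (↭-sym (endpoints-↭ E↭)) p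
  with ∈-++⁻ os (∈-resp-↭ p′ (here refl))
-- The opener o is below its closer suc q, so it cannot be unread.
... | inj₂ o∈ = contradiction (All.lookup (iterate-> q (suc m)) o∈) (≤⇒≯ (s≤s⁻¹ o<q))
... | inj₁ o∈
  with xs , ys , refl ← ∈-∃++ o∈
  with _ , os′≤ ← ++-delete xs os≤
  -- Cancelling o and then suc q leaves the endpoints of the remaining edges.
  with p″ ← drop-∷ (↭-trans (drop-∷ (↭-trans p′ (++⁺ʳ _ (shift o xs ys)))) (shift (suc q) (xs ++ ys) _))
  with refl ← ≡-trans (sym len) (length-++-sucʳ xs o ys)
  with u , eq , π , F , E↭F , s ← scan-covers {length (xs ++ ys)} m (suc q) (xs ++ ys) (E₁ ++ E₂) refl
         (All.tail (open-next os′≤))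
         (All.tabulate λ e∈ → proj₁ (All.lookup E′< e∈) ,
           ≤∧≢⇒< (proj₂ (All.lookup E′< e∈)) (closer-≢ m os′≤ p″ e∈))
         p″ =
  u , cong suc eq , down π , (o , suc q) ∷ F , ↭-trans E↭ (prep _ E↭F) , closes xs s

-- Binomial coefficients

pascal : ∀ n k → suc n C suc k ≡ n C k + n C suc k
pascal n k = sym (nCk+nC[k+1]≡[n+1]C[k+1] n k)

nC0≡1 : ∀ n → n C 0 ≡ 1
nC0≡1 n = ≡-trans (nCk≡nC[n∸k] {0} {n} z≤n) (nCn≡1 n)

-- n C (k − 1), with value 0 at k = 0, where truncated subtraction would give n C 0.
binomialPred : ℕ → ℕ → ℕ
binomialPred n zero    = 0
binomialPred n (suc k) = n C k

pascalPred : ∀ n k → suc n C k ≡ binomialPred n k + n C k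
pascalPred n zero    = ≡-trans (nC0≡1 (suc n)) (sym (nC0≡1 n))
pascalPred n (suc k) = pascal n k

partialSum : ℕ → ℕ → ℕ
partialSum n zero    = 0
partialSum n (suc k) = partialSum n k + n C k

partialSum-pascal : ∀ n k → partialSum (suc n) (suc k) ≡ partialSum n k + partialSum n (suc k)
partialSum-pascal n zero    = pascalPred n 0
partialSum-pascal n (suc k) = begin
  partialSum (suc n) (suc k) + suc n C suc k           ≡⟨ cong₂ _+_ (partialSum-pascal n k) (pascal n k) ⟩
  partialSum n k + (partialSum n k + n C k) + (n C k + n C suc k)
    ≡⟨ rearrange (partialSum n k) (n C k) (n C suc k) ⟩
  partialSum n k + n C k + (partialSum n k + n C k + n C suc k) ∎
  where
  open ≡-Reasoning
  rearrange : ∀ g a b → g + (g + a) + (a + b) ≡ g + a + (g + a + b)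
  rearrange = solve-∀

-- The identity (k + 1) C(n, k + 1) = (n - k) C(n, k), with the negative term moved to the left.
absorption : ∀ n k → suc k * (n C suc k) + k * (n C k) ≡ n * (n C k)
absorption zero zero    = refl
absorption zero (suc k) = ≡-trans (cong₂ _+_ (*-zeroʳ (2 + k)) (*-zeroʳ (suc k))) refl
absorption (suc n) zero = begin
  1 * (suc n C 1) + 0 * (suc n C 0)    ≡⟨ cong (λ x → 1 * x + 0) (pascal n 0) ⟩
  1 * (n C 0 + n C 1) + 0              ≡⟨ rearrange (n C 0) (n C 1) ⟩
  n C 0 + (1 * (n C 1) + 0 * (n C 0))  ≡⟨ cong (λ m → n C 0 + m) (absorption n 0) ⟩
  suc n * (n C 0)                      ≡⟨ cong (suc n *_) (pascalPred n 0) ⟨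
  suc n * (suc n C 0)                  ∎
  where
  open ≡-Reasoning
  rearrange : ∀ a b → 1 * (a + b) + 0 ≡ a + (1 * b + 0 * a)
  rearrange = solve-∀
absorption (suc n) (suc k) = begin
  suc (suc k) * (suc n C suc (suc k)) + suc k * (suc n C suc k)
    ≡⟨ cong₂ (λ x y → suc (suc k) * x + suc k * y) (pascal n (suc k)) (pascal n k) ⟩
  suc (suc k) * (b + c) + suc k * (a + b)
    ≡⟨ rearrange k a b c ⟩
  (suc (suc k) * c + suc k * b) + (suc k * b + k * a) + (a + b)
    ≡⟨ cong₂ (λ x y → x + y + (a + b)) (absorption n (suc k)) (absorption n k) ⟩
  n * b + n * a + (a + b)
    ≡⟨ collect n a b ⟩
  suc n * (a + b)
    ≡⟨ cong (suc n *_) (pascal n k) ⟨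
  suc n * (suc n C suc k) ∎
  where
  open ≡-Reasoning
  a = n C k
  b = n C suc k
  c = n C suc (suc k)
  rearrange : ∀ k a b c → suc (suc k) * (b + c) + suc k * (a + b)
    ≡ (suc (suc k) * c + suc k * b) + (suc k * b + k * a) + (a + b)
  rearrange = solve-∀
  collect : ∀ n a b → n * b + n * a + (a + b) ≡ suc n * (a + b)
  collect = solve-∀

central-sym : ∀ n → suc (2 * n) C suc n ≡ suc (2 * n) C n
central-sym n = ≡-trans (nCk≡nC[n∸k] (s≤s (m≤m+n n (n + 0))))
  (cong (suc (2 * n) C_) (≡-trans (m+n∸m≡n n (n + 0)) (+-identityʳ n)))

2*suc : ∀ n → 2 * suc n ≡ suc (suc (2 * n))
2*suc = solve-∀

-- Row 2n is symmetric, so twice its lower half plus the middle term is 2^(2n). The induction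
-- applies Pascal's rule twice, and `central-sym` equates the two middle terms of the odd row in
-- between.
partialSum-central : ∀ n → 2 * partialSum (2 * n) n + (2 * n) C n ≡ 4 ^ n
partialSum-central zero    = refl
partialSum-central (suc n) = begin
  2 * partialSum (2 * suc n) (suc n) + (2 * suc n) C suc n
    ≡⟨ cong (λ m → 2 * partialSum m (suc n) + m C suc n) (2*suc n) ⟩
  2 * partialSum (2 + r) (suc n) + suc (suc r) C suc n
    ≡⟨ cong₂ (λ x y → 2 * x + y) (partialSum-pascal (suc r) n) (pascal (suc r) n) ⟩
  2 * (g + (g + c)) + (c + suc r C suc n)
    ≡⟨ cong (λ x → 2 * (g + (g + c)) + (c + x)) (central-sym n) ⟩
  2 * (g + (g + c)) + (c + c)
    ≡⟨ collect g c ⟩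
  4 * (g + c)
    ≡⟨ cong (4 *_) (partialSum-pascal r n) ⟩
  4 * (partialSum r n + (partialSum r n + r C n))
    ≡⟨ cong (4 *_) (double (partialSum r n) (r C n)) ⟩
  4 * (2 * partialSum r n + r C n)
    ≡⟨ cong (4 *_) (partialSum-central n) ⟩
  4 * 4 ^ n ∎
  where
  open ≡-Reasoning
  r = 2 * n
  g = partialSum (suc r) n
  c = suc r C n
  collect : ∀ g c → 2 * (g + (g + c)) + (c + c) ≡ 4 * (g + c)
  collect = solve-∀
  double : ∀ g c → g + (g + c) ≡ 2 * g + c
  double = solve-∀

-- This is `absorption` in row 2n at n - 1. It trades the C(2n, n - 1) of the path counts for C(2n,
-- n).
central-pred : ∀ n → suc n * binomialPred (2 * n) n ≡ n * ((2 * n) C n)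
central-pred zero    = refl
central-pred (suc k) = +-cancelʳ-≡ (k * b) _ _ (begin
  (2 + k) * b + k * b                      ≡⟨ collect k b ⟩
  2 * suc k * b                            ≡⟨ absorption (2 * suc k) k ⟨
  suc k * ((2 * suc k) C suc k) + k * b    ∎)
  where
  open ≡-Reasoning
  b = (2 * suc k) C k
  collect : ∀ k b → (2 + k) * b + k * b ≡ 2 * suc k * b
  collect = solve-∀

-- The binomial coefficient `h C 2`, which is the weight of the direct descent from height h.
triangular : ℕ → ℕ
triangular zero    = 0
triangular (suc h) = h + triangular h

-- The hypothesis is the formula times 2(n + 1), with the negative term 3n C(2n, n) moved to the
-- left. For unnormalised fractions equality is cross-multiplication, so no reduction to lowest
-- terms interferes.
formula-from-ℕ : ∀ n k →
  2 * suc n * k + 3 * n * ((2 * n) C n) ≡ suc n * 4 ^ n + (2 * n) C n →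
  (ℤ.+ k) ℚ./ 1 ≡ formula n
formula-from-ℕ n k eq = ℚ.toℚᵘ-injective (begin
  toℚᵘ ((ℤ.+ k) ℚ./ 1)               ≈⟨ ℚ.toℚᵘ-fromℚᵘ (mkℚᵘ (ℤ.+ k) 0) ⟩
  mkℚᵘ (ℤ.+ k) 0                     ≈⟨ *≡* main ⟩
  x ℚᵘ.- y ℚᵘ.* z
    ≈⟨ ℚᵘ.+-cong (ℚ.toℚᵘ-fromℚᵘ x) (ℚᵘ.-‿cong (ℚᵘ.*-cong (ℚ.toℚᵘ-fromℚᵘ y) (ℚ.toℚᵘ-fromℚᵘ z))) ⟨
  toℚᵘ (fromℚᵘ x) ℚᵘ.- toℚᵘ (fromℚᵘ y) ℚᵘ.* toℚᵘ (fromℚᵘ z)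
    ≈⟨ ℚᵘ.+-congʳ (toℚᵘ (fromℚᵘ x)) (ℚᵘ.-‿cong (ℚ.toℚᵘ-homo-* (fromℚᵘ y) (fromℚᵘ z))) ⟨
  toℚᵘ (fromℚᵘ x) ℚᵘ.- toℚᵘ (fromℚᵘ y ℚ.* fromℚᵘ z)
    ≈⟨ ℚᵘ.+-congʳ (toℚᵘ (fromℚᵘ x)) (ℚ.toℚᵘ-homo‿- (fromℚᵘ y ℚ.* fromℚᵘ z)) ⟨
  toℚᵘ (fromℚᵘ x) ℚᵘ.+ toℚᵘ (ℚ.- (fromℚᵘ y ℚ.* fromℚᵘ z))
    ≈⟨ ℚ.toℚᵘ-homo-+ (fromℚᵘ x) _ ⟨
  toℚᵘ (formula n) ∎)
  where
  open ℚᵘ.≃-Reasoning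
  c = (2 * n) C n
  x y z : ℚᵘ
  -- `mkℚᵘ` takes the denominator minus one: the denominators are 2, 2 * suc n and 1.
  x = mkℚᵘ (ℤ.+ (4 ^ n)) 1
  y = mkℚᵘ (ℤ.+ (3 * n) ℤ.- ℤ.+ 1) (n + (suc n + 0))
  z = mkℚᵘ (ℤ.+ c) 0
  main : ℤ.+ k ℤ.* ℚᵘ.↧ (x ℚᵘ.- y ℚᵘ.* z) ≡ ℚᵘ.↥ (x ℚᵘ.- y ℚᵘ.* z) ℤ.* ℤ.+ 1
  main = ≡.begin
    ℤ.+ k ℤ.* ℤ.+ (2 * (2 * suc n * 1))
      ≡.≡⟨ cong (ℤ.+ k ℤ.*_) denominator ⟩
    ℤ.+ k ℤ.* (two ℤ.* (two ℤ.* (ℤ.1ℤ ℤ.+ N)))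
      -- Cross-multiplication leaves twice the hypothesis; adding and subtracting 6 N c exposes the
      -- left side of `eqℤ`.
      ≡.≡⟨ expandˡ (ℤ.+ k) N (ℤ.+ c) ⟩
    two ℤ.* (two ℤ.* (ℤ.1ℤ ℤ.+ N) ℤ.* ℤ.+ k ℤ.+ three ℤ.* N ℤ.* ℤ.+ c) ℤ.- two ℤ.* three ℤ.* N ℤ.* ℤ.+ c
      ≡.≡⟨ cong (λ t → two ℤ.* t ℤ.- two ℤ.* three ℤ.* N ℤ.* ℤ.+ c) eqℤ ⟩
    two ℤ.* ((ℤ.1ℤ ℤ.+ N) ℤ.* P ℤ.+ ℤ.+ c) ℤ.- two ℤ.* three ℤ.* N ℤ.* ℤ.+ c
      ≡.≡⟨ expandʳ P N (ℤ.+ c) ⟩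
    (P ℤ.* (two ℤ.* (ℤ.1ℤ ℤ.+ N)) ℤ.+ ℤ.- ((three ℤ.* N ℤ.- ℤ.1ℤ) ℤ.* ℤ.+ c) ℤ.* two) ℤ.* ℤ.1ℤ
      ≡.≡⟨ cong₂ (λ d t → (P ℤ.* d ℤ.+ ℤ.- ((t ℤ.- ℤ.1ℤ) ℤ.* ℤ.+ c) ℤ.* two) ℤ.* ℤ.1ℤ)
             denominator′ (ℤ.pos-* 3 n) ⟨
    (P ℤ.* ℤ.+ (2 * suc n * 1) ℤ.+ ℤ.- ((ℤ.+ (3 * n) ℤ.- ℤ.1ℤ) ℤ.* ℤ.+ c) ℤ.* two) ℤ.* ℤ.1ℤ
      ≡.∎
    where
    module ≡ = ≡-Reasoning
    N = ℤ.+ n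
    P = ℤ.+ (4 ^ n)
    two = ℤ.+ 2
    three = ℤ.+ 3
    denominator′ : ℤ.+ (2 * suc n * 1) ≡ two ℤ.* (ℤ.1ℤ ℤ.+ N)
    denominator′ = ≡-trans (cong ℤ.+_ (*-identityʳ (2 * suc n))) (ℤ.pos-* 2 (suc n))
    denominator : ℤ.+ (2 * (2 * suc n * 1)) ≡ two ℤ.* (two ℤ.* (ℤ.1ℤ ℤ.+ N))
    denominator = ≡-trans (ℤ.pos-* 2 (2 * suc n * 1)) (cong (two ℤ.*_) denominator′)
    eqℤ : two ℤ.* (ℤ.1ℤ ℤ.+ N) ℤ.* ℤ.+ k ℤ.+ three ℤ.* N ℤ.* ℤ.+ c ≡ (ℤ.1ℤ ℤ.+ N) ℤ.* P ℤ.+ ℤ.+ c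
    eqℤ = ≡.begin
      two ℤ.* (ℤ.1ℤ ℤ.+ N) ℤ.* ℤ.+ k ℤ.+ three ℤ.* N ℤ.* ℤ.+ c
        ≡.≡⟨ cong₂ (λ s t → s ℤ.* ℤ.+ k ℤ.+ t ℤ.* ℤ.+ c) (ℤ.pos-* 2 (suc n)) (ℤ.pos-* 3 n) ⟨
      ℤ.+ (2 * suc n) ℤ.* ℤ.+ k ℤ.+ ℤ.+ (3 * n) ℤ.* ℤ.+ c
        ≡.≡⟨ cong₂ ℤ._+_ (ℤ.pos-* (2 * suc n) k) (ℤ.pos-* (3 * n) c) ⟨
      ℤ.+ (2 * suc n * k + 3 * n * c)
        ≡.≡⟨ cong ℤ.+_ eq ⟩
      ℤ.+ (suc n * 4 ^ n + c)
        ≡.≡⟨ cong (ℤ._+ ℤ.+ c) (ℤ.pos-* (suc n) (4 ^ n)) ⟩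
      (ℤ.1ℤ ℤ.+ N) ℤ.* P ℤ.+ ℤ.+ c
        ≡.∎
    expandˡ : ∀ K N C → K ℤ.* (ℤ.+ 2 ℤ.* (ℤ.+ 2 ℤ.* (ℤ.1ℤ ℤ.+ N)))
      ≡ ℤ.+ 2 ℤ.* (ℤ.+ 2 ℤ.* (ℤ.1ℤ ℤ.+ N) ℤ.* K ℤ.+ ℤ.+ 3 ℤ.* N ℤ.* C) ℤ.- ℤ.+ 2 ℤ.* ℤ.+ 3 ℤ.* N ℤ.* C
    expandˡ = ℤSolver.solve-∀
    expandʳ : ∀ P N C → ℤ.+ 2 ℤ.* ((ℤ.1ℤ ℤ.+ N) ℤ.* P ℤ.+ C) ℤ.- ℤ.+ 2 ℤ.* ℤ.+ 3 ℤ.* N ℤ.* C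
      ≡ (P ℤ.* (ℤ.+ 2 ℤ.* (ℤ.1ℤ ℤ.+ N)) ℤ.+ ℤ.- ((ℤ.+ 3 ℤ.* N ℤ.- ℤ.1ℤ) ℤ.* C) ℤ.* ℤ.+ 2) ℤ.* ℤ.1ℤ
    expandʳ = ℤSolver.solve-∀

-- The classes and their number

oneTo≡iterate : ∀ m → oneTo m ≡ iterate suc 1 m
oneTo≡iterate m = go id 0 m λ i → sym (+-identityʳ i)
  where
  go : ∀ f q m → (∀ i → f i ≡ i + q) → map suc (applyUpTo f m) ≡ iterate suc (suc q) m
  go f q zero    eq = refl
  go f q (suc m) eq = cong₂ _∷_ (cong suc (eq 0))
    (go (f ∘ suc) (suc q) m λ i → ≡-trans (eq (suc i)) (sym (+-suc i q)))

paths : ∀ h u → List (Path h u)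
paths zero    zero    = stop ∷ []
paths zero    (suc u) = map up (paths 1 u)
paths (suc h) zero    = map down (paths h zero)
paths (suc h) (suc u) = map up (paths (2 + h) u) ++ map down (paths h (suc u))

∈-paths : ∀ {h u} (π : Path h u) → π ∈ paths h u
∈-paths stop                       = here refl
∈-paths (up {zero} π)              = ∈-map⁺ up (∈-paths π)
∈-paths (up {suc h} π)             = ∈-++⁺ˡ (∈-map⁺ up (∈-paths π))
∈-paths (down {u = zero} π)        = ∈-map⁺ down (∈-paths π)
∈-paths (down {h} {u = suc u} π) = ∈-++⁺ʳ (map up (paths (2 + h) u)) (∈-map⁺ down (∈-paths π))

up-injective : ∀ {h u} {π ρ : Path (suc h) u} → Path.up π ≡ up ρ → π ≡ ρ
up-injective refl = refl

down-injective : ∀ {h u} {π ρ : Path h u} → Path.down π ≡ down ρ → π ≡ ρ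
down-injective refl = refl

paths-unique : ∀ h u → Unique (paths h u)
paths-unique zero    zero    = [] ∷ []
paths-unique zero    (suc u) = Unique.map⁺ up-injective (paths-unique 1 u)
paths-unique (suc h) zero    = Unique.map⁺ down-injective (paths-unique h zero)
paths-unique (suc h) (suc u) = Unique.++⁺
  (Unique.map⁺ up-injective (paths-unique (2 + h) u))
  (Unique.map⁺ down-injective (paths-unique h (suc u)))
  λ (∈up , ∈down) → case ∈-map⁻ up ∈up , ∈-map⁻ down ∈down of λ { ((_ , _ , refl) , (_ , _ , ())) }

-- A code (π , v) stands for the class of the matchings with shape π and v nestings.
Code : ℕ → Set
Code n = Path 0 n × ℕ

codesOf : ∀ {n} → Path 0 n → List (Code n)
codesOf π = map (π ,_) (upTo (suc (weight π)))

codes : ∀ n → List (Code n)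
codes n = concatMap codesOf (paths 0 n)

∈-codes : ∀ {n} (π : Path 0 n) {v} → v ≤ weight π → (π , v) ∈ codes n
∈-codes π v≤ = ∈-concatMap⁺ codesOf (Any.map (λ { refl → ∈-map⁺ (π ,_) (∈-upTo⁺ (s≤s v≤)) }) (∈-paths π))

∈-codes⇒≤ : ∀ {n} {c : Code n} → c ∈ codes n → proj₂ c ≤ weight (proj₁ c)
∈-codes⇒≤ {n} c∈ with π , _ , c∈π ← find (∈-concatMap⁻ codesOf {xs = paths 0 n} c∈)
  with v , v∈ , refl ← ∈-map⁻ (π ,_) c∈π = s≤s⁻¹ (∈-upTo⁻ v∈)

codes-unique : ∀ n → Unique (codes n)
codes-unique n = Unique.concat⁺
  (All.map⁺ (All.universal (λ π → Unique.map⁺ (λ { refl → refl }) (Unique.upTo⁺ (suc (weight π)))) (paths 0 n)))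
  (AllPairs.map⁺ (AllPairs.map disjoint (paths-unique 0 n)))
  where
  disjoint : ∀ {π ρ : Path 0 n} → π ≢ ρ → ∀ {c} → c ∈ codesOf π × c ∈ codesOf ρ → _
  disjoint π≢ρ (c∈π , c∈ρ) with _ , _ , refl ← ∈-map⁻ _ c∈π | _ , _ , refl ← ∈-map⁻ _ c∈ρ = π≢ρ refl

lookup-injective : ∀ {xs : List A} → Unique xs → ∀ i j → lookup xs i ≡ lookup xs j → i ≡ j
lookup-injective {xs = x ∷ xs} (x∉ ∷ xs!) zero    zero    eq = refl
lookup-injective {xs = x ∷ xs} (x∉ ∷ xs!) zero    (suc j) eq = contradiction eq (All.lookup x∉ (∈-lookup j))
lookup-injective {xs = x ∷ xs} (x∉ ∷ xs!) (suc i) zero    eq = contradiction (sym eq) (All.lookup x∉ (∈-lookup i))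
lookup-injective {xs = x ∷ xs} (x∉ ∷ xs!) (suc i) (suc j) eq = cong suc (lookup-injective xs! i j eq)

-- Codes with v > weight π, which do not occur in codes n, are clamped.
representative : ∀ {n} (c : Code n) → ∃ λ E → Σ (Scan 0 [] (proj₁ c) E) λ s → nestings s ≡ proj₂ c ⊓ weight (proj₁ c)
representative (π , v) = scan-exists 0 [] π refl (m⊓n≤n v (weight π))

scan-isMatching : ∀ {n E} {π : Path 0 n} → Scan 0 [] π E → IsMatching n E
scan-isMatching {n} s = All.map (λ { {_ , _} ((_ , a<b) , _) → a<b }) (scan-edges s []) ,
  ↭-trans (scan-endpoints s) (↭-reflexive (sym (oneTo≡iterate (2 * n))))

scan-ordered : ∀ {n E} {π : Path 0 n} → Scan 0 [] π E → All Ordered E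
scan-ordered s = All.map proj₁ (scan-edges s [])

matching : ∀ {n} → Code n → Matching n
matching c = let E , s , _ = representative c in E , scan-isMatching s

-- The closing counts up to 2n cover the whole path and so determine it, while level 0 determines
-- the number of nestings.
scan-∼ne-injective : ∀ {n E F} {π ρ : Path 0 n} (s : Scan 0 [] π E) (t : Scan 0 [] ρ F) → E ∼ne F →
  π ≡ ρ × nestings s ≡ nestings t
scan-∼ne-injective {n} {E} {F} {π} {ρ} s t E∼F = downs-injective π ρ downs≡ ,
  ≡-trans (sym (scan-ne s [] [])) (≡-trans (∼ne⇒≡-ne {E} {F} E∼F) (scan-ne t [] []))
  where
  downs≡ : ∀ {i} → i ≤ 2 * n → downs π i ≡ downs ρ i
  downs≡ {i} i≤ = begin
    downs π i   ≡⟨ scan-closed s [] i ⟨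
    closed i E  ≡⟨ ∼ne⇒≡-closed (scan-ordered s) (scan-ordered t)
                     (≡-trans (length-scan s) (sym (length-scan t))) E∼F
                     (subst (λ m → i ≤ 2 * m) (sym (length-scan s)) i≤) ⟩
    closed i F  ≡⟨ scan-closed t [] i ⟩
    downs ρ i   ∎
    where open ≡-Reasoning

matching-injective : ∀ {n} {c d : Code n} → proj₂ c ≤ weight (proj₁ c) → proj₂ d ≤ weight (proj₁ d) →
  proj₁ (matching c) ∼ne proj₁ (matching d) → c ≡ d
matching-injective {c = π , v} {ρ , w} v≤ w≤ c∼d = cong₂ _,_ (proj₁ s≈t) (begin
  v               ≡⟨ m≤n⇒m⊓n≡m v≤ ⟨
  v ⊓ weight π    ≡⟨ proj₂ (proj₂ (representative (π , v))) ⟨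
  nestings s      ≡⟨ proj₂ s≈t ⟩
  nestings t      ≡⟨ proj₂ (proj₂ (representative (ρ , w))) ⟩
  w ⊓ weight ρ    ≡⟨ m≤n⇒m⊓n≡m w≤ ⟩
  w               ∎)
  where
  open ≡-Reasoning
  s = proj₁ (proj₂ (representative (π , v)))
  t = proj₁ (proj₂ (representative (ρ , w)))
  s≈t = scan-∼ne-injective s t c∼d

endpoints-positive : ∀ {E} → All (0 <_) (endpoints E) → All (λ e → 0 < proj₁ e × 0 < proj₂ e) E
endpoints-positive {[]}    []               = []
endpoints-positive {_ ∷ _} (a> ∷ b> ∷ rest) = (a> , b>) ∷ endpoints-positive rest

-- The scan of M supplies the code. The representative may pair the vertices differently, but it has
-- the same path and number of nestings, hence the same invariants.
matching-covers : ∀ {n} (M : Matching n) → ∃ λ c → c ∈ codes n × proj₁ M ∼ne proj₁ (matching c)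
matching-covers {n} (E , E< , E↭)
  with E↭′ ← ↭-trans E↭ (↭-reflexive (oneTo≡iterate (2 * n)))
  with E<′ ← All.zipWith (λ { {a , b} (a<b , 0<a , 0<b) → (0<a , a<b) , 0<b })
               (E< , endpoints-positive (All-resp-↭ (↭-sym E↭′) (iterate-> 0 (2 * n))))
  with u , 2u≡2n , π , F , E↭F , s ← scan-covers (2 * n) 0 [] E refl [] E<′ E↭′
  with refl ← *-cancelˡ-≡ u n 2 2u≡2n
  = let G , t , t≡ = representative (π , nestings s) in
  (π , nestings s) , ∈-codes π (nestings≤weight s) ,
  ≈ᵐ⇒∼ne record
    { orderedˡ = All.map proj₁ E<′
    ; orderedʳ = scan-ordered t
    ; ≡-length = ≡-trans (↭-length E↭F) (≡-trans (length-scan s) (sym (length-scan t)))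
    ; ≡-ne     = ≡-trans (ne-↭ E↭F) (≡-trans (scan-ne s [] [])
                   (≡-trans (sym (≡-trans t≡ (m≤n⇒m⊓n≡m (nestings≤weight s)))) (sym (scan-ne t [] []))))
    ; ≡-closed = λ i → ≡-trans (count-↭ _ E↭F) (≡-trans (scan-closed s [] i) (sym (scan-closed t [] i)))
    }

hasNumClasses : ∀ n → HasNumClasses n (length (codes n))
hasNumClasses n = matching ∘ lookup (codes n) , distinct , covers
  where
  distinct : ∀ i j → proj₁ (matching (lookup (codes n) i)) ∼ne proj₁ (matching (lookup (codes n) j)) → i ≡ j
  distinct i j i∼j = lookup-injective (codes-unique n) i j
    (matching-injective (∈-codes⇒≤ {n} (∈-lookup i)) (∈-codes⇒≤ {n} (∈-lookup j)) i∼j)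
  covers : ∀ M → ∃ λ i → proj₁ M ∼ne proj₁ (matching (lookup (codes n) i))
  covers M = let c , c∈ , M∼c = matching-covers M in
    Any.index c∈ , subst (λ c → proj₁ M ∼ne proj₁ (matching {n} c)) (lookup-index c∈) M∼c

-- Summation over lattice paths

totalWeight : ∀ h u → ℕ
totalWeight h u = sum (map weight (paths h u))

sum-map-up : ∀ {h u} (πs : List (Path (suc h) u)) → sum (map weight (map (Path.up) πs)) ≡ sum (map weight πs)
sum-map-up πs = cong sum (sym (map-∘ πs))

sum-map-down : ∀ {h u} (πs : List (Path h u)) →
  sum (map weight (map Path.down πs)) ≡ h * length πs + sum (map weight πs)
sum-map-down {h} []       = sym (≡-trans (+-identityʳ (h * 0)) (*-zeroʳ h))
sum-map-down {h} (π ∷ πs) rewrite sum-map-down πs = rearrange h (weight π) (length πs) (sum (map weight πs))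
  where
  rearrange : ∀ h w l s → h + w + (h * l + s) ≡ h * suc l + (w + s)
  rearrange = solve-∀

-- The values 0 to weight π give weight π + 1 codes for each π; the summands 1 count the paths.
length-codes : ∀ n → length (codes n) ≡ length (paths 0 n) + totalWeight 0 n
length-codes n = go (paths 0 n)
  where
  rearrange : ∀ w l s → suc w + (l + s) ≡ suc l + (w + s)
  rearrange = solve-∀
  go : (πs : List (Path 0 n)) → length (concatMap codesOf πs) ≡ length πs + sum (map weight πs)
  go []       = refl
  go (π ∷ πs) = begin
    length (codesOf π ++ concatMap codesOf πs)             ≡⟨ length-++ (codesOf π) ⟩
    length (codesOf π) + length (concatMap codesOf πs)
      ≡⟨ cong₂ _+_ (≡-trans (length-map (π ,_) (upTo (suc (weight π)))) (length-upTo (suc (weight π)))) (go πs) ⟩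
    suc (weight π) + (length πs + sum (map weight πs))
      ≡⟨ rearrange (weight π) (length πs) (sum (map weight πs)) ⟩
    suc (length πs) + (weight π + sum (map weight πs))     ∎
    where open ≡-Reasoning

length-paths-suc : ∀ h u → length (paths (suc h) (suc u)) ≡ length (paths (2 + h) u) + length (paths h (suc u))
length-paths-suc h u = ≡-trans (length-++ (map up (paths (2 + h) u)))
  (cong₂ _+_ (length-map up (paths (2 + h) u)) (length-map down (paths h (suc u))))

totalWeight-suc : ∀ h u → totalWeight (suc h) (suc u)
  ≡ totalWeight (2 + h) u + (h * length (paths h (suc u)) + totalWeight h (suc u))
totalWeight-suc h u = begin
  sum (map weight (map up πs ++ map down ρs))              ≡⟨ cong sum (map-++ weight (map up πs) (map down ρs)) ⟩
  sum (map weight (map up πs) ++ map weight (map down ρs)) ≡⟨ sum-++ (map weight (map up πs)) _ ⟩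
  sum (map weight (map up πs)) + sum (map weight (map down ρs))
    ≡⟨ cong₂ _+_ (sum-map-up πs) (sum-map-down ρs) ⟩
  totalWeight (2 + h) u + (h * length ρs + totalWeight h (suc u)) ∎
  where
  open ≡-Reasoning
  πs = paths (2 + h) u
  ρs = paths h (suc u)

-- These are the ballot numbers C(r, u) - C(r, u - 1) of the reflection principle. Splitting off the
-- first step matches Pascal's rule in both terms.
length-paths : ∀ h u {r} → r ≡ h + 2 * u → length (paths h u) + binomialPred r u ≡ r C u
length-paths zero zero refl = refl
length-paths (suc h) zero {suc r} eq = begin
  length (map down (paths h 0)) + 0  ≡⟨ cong (_+ 0) (length-map down (paths h 0)) ⟩
  length (paths h 0) + 0             ≡⟨ length-paths h 0 (suc-injective eq) ⟩
  r C 0                              ≡⟨ pascalPred r 0 ⟨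
  suc r C 0                          ∎
  where open ≡-Reasoning
-- From height 0 only an up-step is possible; the symmetry of row 2u + 1 supplies the other term of
-- Pascal's rule.
length-paths zero (suc u) eq with refl ← ≡-trans eq (2*suc u) = begin
  length (map up (paths 1 u)) + (2 + 2 * u) C u
    ≡⟨ cong₂ _+_ (length-map up (paths 1 u)) (pascalPred (1 + 2 * u) u) ⟩
  l + (b + a)                                       ≡⟨ +-assoc l b a ⟨
  l + b + a                                         ≡⟨ cong₂ _+_ (length-paths 1 u refl) (sym (central-sym u)) ⟩
  a + (1 + 2 * u) C suc u                           ≡⟨ pascal (1 + 2 * u) u ⟨
  (2 + 2 * u) C suc u                               ∎
  where
  open ≡-Reasoning
  l = length (paths 1 u)
  a = (1 + 2 * u) C u
  b = binomialPred (1 + 2 * u) u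
length-paths (suc h) (suc u) {suc r} eq = begin
  length (paths (suc h) (suc u)) + suc r C u   ≡⟨ cong₂ _+_ (length-paths-suc h u) (pascalPred r u) ⟩
  l + m + (b + a)                              ≡⟨ rearrange l m b a ⟩
  (l + b) + (m + a)
    ≡⟨ cong₂ _+_ (length-paths (2 + h) u r≡) (length-paths h (suc u) (suc-injective eq)) ⟩
  a + r C suc u                                ≡⟨ pascal r u ⟨
  suc r C suc u                                ∎
  where
  open ≡-Reasoning
  r≡ : r ≡ 2 + h + 2 * u
  r≡ = ≡-trans (suc-injective eq) (sym (length-up h u))
  l = length (paths (2 + h) u)
  m = length (paths h (suc u))
  a = r C u
  b = binomialPred r u
  rearrange : ∀ l m b a → l + m + (b + a) ≡ (l + b) + (m + a)
  rearrange = solve-∀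

-- binomialPred r u is a negative term of the closed form, moved to the left so that no subtraction occurs.
totalWeight-formula : ∀ h u {r} → r ≡ h + 2 * u →
  totalWeight h u + binomialPred r u ≡ triangular h * (r C u) + suc h * partialSum r u
totalWeight-formula zero zero refl = refl
totalWeight-formula (suc h) zero {suc r} eq = begin
  totalWeight (suc h) 0 + 0
    ≡⟨ cong (_+ 0) (sum-map-down (paths h 0)) ⟩
  h * l + s + 0
    ≡⟨ rearrange h l s ⟩
  h * (l + 0) + (s + 0)
    ≡⟨ cong₂ (λ x y → h * x + y) (length-paths h 0 (suc-injective eq)) (totalWeight-formula h 0 (suc-injective eq)) ⟩
  h * (r C 0) + (t * (r C 0) + suc h * 0)
    ≡⟨ collect h t (r C 0) ⟩
  (h + t) * (r C 0) + suc (suc h) * 0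
    ≡⟨ cong (λ x → (h + t) * x + suc (suc h) * 0) (pascalPred r 0) ⟨
  (h + t) * (suc r C 0) + suc (suc h) * 0 ∎
  where
  open ≡-Reasoning
  l = length (paths h 0)
  s = totalWeight h 0
  t = triangular h
  rearrange : ∀ h l s → h * l + s + 0 ≡ h * (l + 0) + (s + 0)
  rearrange = solve-∀
  collect : ∀ h t c → h * c + (t * c + suc h * 0) ≡ (h + t) * c + suc (suc h) * 0
  collect = solve-∀
totalWeight-formula zero (suc u) eq with refl ← ≡-trans eq (2*suc u) = begin
  totalWeight 0 (suc u) + (2 + 2 * u) C u
    ≡⟨ cong₂ _+_ (sum-map-up (paths 1 u)) (pascalPred (1 + 2 * u) u) ⟩
  s + (b + a)                                 ≡⟨ +-assoc s b a ⟨
  s + b + a                                   ≡⟨ cong (_+ a) (totalWeight-formula 1 u refl) ⟩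
  2 * g + a                                   ≡⟨ collect g a ⟩
  1 * (g + (g + a))                           ≡⟨ cong (1 *_) (partialSum-pascal (1 + 2 * u) u) ⟨
  1 * partialSum (2 + 2 * u) (suc u)          ∎
  where
  open ≡-Reasoning
  s = totalWeight 1 u
  a = (1 + 2 * u) C u
  b = binomialPred (1 + 2 * u) u
  g = partialSum (1 + 2 * u) u
  collect : ∀ g a → 2 * g + a ≡ 1 * (g + (g + a))
  collect = solve-∀
totalWeight-formula (suc h) (suc u) {suc r} eq = begin
  totalWeight (suc h) (suc u) + suc r C u
    ≡⟨ cong₂ _+_ (totalWeight-suc h u) (pascalPred r u) ⟩
  s + (h * m + s′) + (b + a)
    ≡⟨ rearrange s h m s′ b a ⟩
  (s + b) + (s′ + a) + h * m
    ≡⟨ cong₂ (λ x y → x + y + h * m)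
         (totalWeight-formula (2 + h) u r≡) (totalWeight-formula h (suc u) (suc-injective eq)) ⟩
  triangular (2 + h) * a + (3 + h) * g + (t * (r C suc u) + suc h * (g + a)) + h * m
    -- Writing C(r, u + 1) as m + a lets the extra h * m of the down-steps be absorbed; the same
    -- identity then restores it.
    ≡⟨ cong (λ x → triangular (2 + h) * a + (3 + h) * g + (t * x + suc h * (g + a)) + h * m)
         (length-paths h (suc u) (suc-injective eq)) ⟨
  triangular (2 + h) * a + (3 + h) * g + (t * (m + a) + suc h * (g + a)) + h * m
    ≡⟨ collect h t a g m ⟩
  (h + t) * (a + (m + a)) + (2 + h) * (g + (g + a))
    ≡⟨ cong (λ x → (h + t) * (a + x) + (2 + h) * (g + (g + a))) (length-paths h (suc u) (suc-injective eq)) ⟩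
  (h + t) * (a + r C suc u) + (2 + h) * (g + (g + a))
    ≡⟨ cong₂ (λ x y → (h + t) * x + (2 + h) * y) (pascal r u) (partialSum-pascal r u) ⟨
  (h + t) * (suc r C suc u) + (2 + h) * partialSum (suc r) (suc u) ∎
  where
  open ≡-Reasoning
  r≡ : r ≡ 2 + h + 2 * u
  r≡ = ≡-trans (suc-injective eq) (sym (length-up h u))
  s = totalWeight (2 + h) u
  s′ = totalWeight h (suc u)
  m = length (paths h (suc u))
  t = triangular h
  a = r C u
  b = binomialPred r u
  g = partialSum r u
  rearrange : ∀ s h m s′ b a → s + (h * m + s′) + (b + a) ≡ (s + b) + (s′ + a) + h * m
  rearrange = solve-∀
  collect : ∀ h t a g m →
    (1 + h + (h + t)) * a + (3 + h) * g + (t * (m + a) + suc h * (g + a)) + h * m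
    ≡ (h + t) * (a + (m + a)) + (2 + h) * (g + (g + a))
  collect = solve-∀

-- The closed forms for l and s each need a summand b, with factor 2(n + 1); hence 4(n + 1) b is
-- added to both sides. On the right `central-pred` identifies it with 4n C(2n, n).
codes-count : ∀ n → 2 * suc n * length (codes n) + 3 * n * ((2 * n) C n) ≡ suc n * 4 ^ n + (2 * n) C n
codes-count n = +-cancelʳ-≡ (4 * (suc n * b)) _ _ (begin
  2 * suc n * length (codes n) + 3 * n * c + 4 * (suc n * b)
    ≡⟨ cong (λ x → 2 * suc n * x + 3 * n * c + 4 * (suc n * b)) (length-codes n) ⟩
  2 * suc n * (l + s) + 3 * n * c + 4 * (suc n * b)
    ≡⟨ rearrange n l s b c ⟩
  2 * suc n * ((l + b) + (s + b)) + 3 * n * c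
    ≡⟨ cong₂ (λ x y → 2 * suc n * (x + y) + 3 * n * c) (length-paths 0 n refl) (totalWeight-formula 0 n refl) ⟩
  2 * suc n * (c + 1 * g) + 3 * n * c
    ≡⟨ collect n c g ⟩
  suc n * (2 * g + c) + c + 4 * (n * c)
    ≡⟨ cong₂ (λ x y → suc n * x + c + 4 * y) (partialSum-central n) (sym (central-pred n)) ⟩
  suc n * 4 ^ n + c + 4 * (suc n * b) ∎)
  where
  open ≡-Reasoning
  l = length (paths 0 n)
  s = totalWeight 0 n
  b = binomialPred (2 * n) n
  c = (2 * n) C n
  g = partialSum (2 * n) n
  rearrange : ∀ n l s b c → 2 * suc n * (l + s) + 3 * n * c + 4 * (suc n * b)
    ≡ 2 * suc n * ((l + b) + (s + b)) + 3 * n * c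
  rearrange = solve-∀
  collect : ∀ n c g → 2 * suc n * (c + 1 * g) + 3 * n * c ≡ suc n * (2 * g + c) + c + 4 * (n * c)
  collect = solve-∀

theorem3p5 : (n : ℕ) → ∃ λ (k : ℕ) → HasNumClasses n k × ((+ k) / 1 ≡ formula n)
theorem3p5 n = length (codes n) , hasNumClasses n , formula-from-ℕ n (length (codes n)) (codes-count n)
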